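{- Let $(C,e,\lambda,\oplus)$ be a Catalan structure and let $h\colon C\to C$ be the map defined in the context. The fixed points of $h$ are exactly $e$ and the elements $$u\oplus\lambda(h(u))\quad\text{for }u\in C.$$ In particular, for every $k\ge 0$ there are $|C_k|$ fixed points of size $2k+1$ (where $|C_k|$ is the $k$-th Catalan number), and there are no fixed points of positive even size.
   Context: A Catalan structure is a quadruple $(C,e,\lambda,\oplus)$ where $C=\bigsqcup_{n\ge 0}C_n$ with $C_0=\{e\}$ (elements of $C_n$ have size $n$), $\lambda\colon C_n\to C_{n+1}$, $\oplus\colon C_m\times C_n\to C_{m+n}$, $\oplus$ is associative with two-sided identity $e$, and every $t\in C$ can be written uniquely in exactly one of three forms: $t=e$; $t=\lambda(s)$ with $s\in C$ (indecomposable); $t=u\oplus v$ with $u$ indecomposable and $v\in C\setminus C_0$ (decomposable). Hence every nonempty $t$ is uniquely $\lambda(u)\oplus v$ ($v=e$ allowed). Put $\gamma(t)=t\oplus\lambda(e)$ and define $\ominus$ by $e\ominus v=v$, $\lambda(u)\ominus v=\lambda(u\ominus v)$, $(t\oplus u)\ominus v=t\oplus(u\ominus v)$ for $t,u\ne e$ (well defined; one may take $t$ indecomposable). The map $h$ is defined by $h(e)=e$ and $h(\lambda(u)\oplus v)=h(v)\ominus\gamma(h(u))$. -}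

module Defs where

open import Data.Empty using (⊥-elim)
open import Data.Nat using (ℕ; suc; _+_; _*_; _/_; _<_; s≤s)
open import Data.Nat.Combinatorics using (_C_)
open import Data.Nat.Induction using (<-wellFounded)
open import Data.Nat.Properties using (≤-reflexive; m≤m+n; m≤n+m; m+n≡0⇒n≡0)
open import Data.Product using (∃; ∃₂; _×_; _,_)
open import Data.Sum using (_⊎_; inj₁; inj₂)
open import Induction.WellFounded using (Acc; acc)
open import Level using (Level)
open import Relation.Binary.PropositionalEquality using (_≡_; _≢_; refl; sym; trans; cong; cong₂; subst)
open import Relation.Nullary using (¬_)

-- The disjoint union C = ⨆ₙ Cₙ is given as a type together with the size
-- function whose fibres are the Cₙ (see Sized below).
record CatalanStructure (ℓ : Level) : Set (Level.suc ℓ) where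
  infixr 6 _⊕_
  field
    Carrier : Set ℓ
    size    : Carrier → ℕ
    e       : Carrier
    ƛ       : Carrier → Carrier
    _⊕_     : Carrier → Carrier → Carrier

    size-e      : size e ≡ 0
    size≡0⇒e    : ∀ t → size t ≡ 0 → t ≡ e
    size-ƛ      : ∀ t → size (ƛ t) ≡ suc (size t)
    size-⊕      : ∀ t u → size (t ⊕ u) ≡ size t + size u

    ⊕-assoc     : ∀ t u v → (t ⊕ u) ⊕ v ≡ t ⊕ (u ⊕ v)
    ⊕-identityˡ : ∀ t → e ⊕ t ≡ t
    ⊕-identityʳ : ∀ t → t ⊕ e ≡ t

  Indecomposable : Carrier → Set ℓ
  Indecomposable t = ∃ λ s → t ≡ ƛ s

  Decomposable : Carrier → Set ℓ
  Decomposable t = ∃₂ λ u v → Indecomposable u × v ≢ e × t ≡ u ⊕ v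

  field
    form : ∀ t → t ≡ e ⊎ Indecomposable t ⊎ Decomposable t

    e-not-indecomposable : ¬ Indecomposable e
    e-not-decomposable   : ¬ Decomposable e
    indecomposable-not-decomposable : ∀ {t} → Indecomposable t → ¬ Decomposable t

    ƛ-injective : ∀ {s s′} → ƛ s ≡ ƛ s′ → s ≡ s′
    ⊕-unique    : ∀ {u v u′ v′} → Indecomposable u → v ≢ e →
                  Indecomposable u′ → v′ ≢ e →
                  u ⊕ v ≡ u′ ⊕ v′ → u ≡ u′ × v ≡ v′

  Sized : ℕ → Set ℓ
  Sized n = ∃ λ t → size t ≡ n

module Operations {ℓ : Level} (S : CatalanStructure ℓ) where
  open CatalanStructure S

  -- Recursion over the decomposition of t.  The decomposition tree of an
  -- element exists by induction on size, and it is unique up to the value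
  -- computed from it (fold-cong).
  data Decomposition : Carrier → Set ℓ where
    empty : Decomposition e
    ind   : ∀ s → Decomposition s → Decomposition (ƛ s)
    dec   : ∀ s v → v ≢ e → Decomposition s → Decomposition v →
            Decomposition (ƛ s ⊕ v)

  private
    decompose-acc : ∀ t → Acc _<_ (size t) → Decomposition t
    decompose-acc t (acc rs) with form t
    ... | inj₁ refl = empty
    ... | inj₂ (inj₁ (s , refl)) =
          ind s (decompose-acc s (rs (≤-reflexive (sym (size-ƛ s)))))
    ... | inj₂ (inj₂ (_ , v , (s , refl) , v≢e , refl)) =
          dec s v v≢e
            (decompose-acc s (rs (subst (size s <_) (sym size-eq)
              (s≤s (m≤m+n (size s) (size v))))))
            (decompose-acc v (rs (subst (size v <_) (sym size-eq)
              (s≤s (m≤n+m (size v) (size s))))))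
          where
            size-eq : size (ƛ s ⊕ v) ≡ suc (size s + size v)
            size-eq = trans (size-⊕ (ƛ s) v) (cong (_+ size v) (size-ƛ s))

  decompose : ∀ t → Decomposition t
  decompose t = decompose-acc t (<-wellFounded (size t))

  module Fold {a : Level} {A : Set a} (z : A) (f : A → A)
              (g : Carrier → A → A → A) where

    foldD : ∀ {t} → Decomposition t → A
    foldD empty              = z
    foldD (ind _ d)          = f (foldD d)
    foldD (dec s _ _ d₁ d₂)  = g s (foldD d₁) (foldD d₂)

    fold : Carrier → A
    fold t = foldD (decompose t)

    fold-cong : ∀ {t t′} (d : Decomposition t) (d′ : Decomposition t′) →
                t ≡ t′ → foldD d ≡ foldD d′
    fold-cong empty empty _ = refl
    fold-cong empty (ind s _) eq = ⊥-elim (e-not-indecomposable (s , eq))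
    fold-cong empty (dec s v v≢e _ _) eq =
      ⊥-elim (e-not-decomposable (ƛ s , v , (s , refl) , v≢e , eq))
    fold-cong (ind s _) empty eq = ⊥-elim (e-not-indecomposable (s , sym eq))
    fold-cong (ind _ d) (ind _ d′) eq = cong f (fold-cong d d′ (ƛ-injective eq))
    fold-cong (ind s _) (dec s′ v v≢e _ _) eq =
      ⊥-elim (indecomposable-not-decomposable (s , refl)
        (ƛ s′ , v , (s′ , refl) , v≢e , eq))
    fold-cong (dec s v v≢e _ _) empty eq =
      ⊥-elim (e-not-decomposable (ƛ s , v , (s , refl) , v≢e , sym eq))
    fold-cong (dec s v v≢e _ _) (ind s′ _) eq =
      ⊥-elim (indecomposable-not-decomposable (s′ , refl)
        (ƛ s , v , (s , refl) , v≢e , sym eq))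
    fold-cong (dec s v v≢e d₁ d₂) (dec s′ v′ v′≢e d₁′ d₂′) eq
      with ⊕-unique (s , refl) v≢e (s′ , refl) v′≢e eq
    ... | ƛs≡ƛs′ , v≡v′ with ƛ-injective ƛs≡ƛs′
    ... | refl = cong₂ (g s) (fold-cong d₁ d₁′ refl) (fold-cong d₂ d₂′ v≡v′)

    fold-e : fold e ≡ z
    fold-e = fold-cong (decompose e) empty refl

    fold-ƛ : ∀ s → fold (ƛ s) ≡ f (fold s)
    fold-ƛ s = fold-cong (decompose (ƛ s)) (ind s (decompose s)) refl

    fold-⊕ : ∀ s v → v ≢ e → fold (ƛ s ⊕ v) ≡ g s (fold s) (fold v)
    fold-⊕ s v v≢e =
      fold-cong (decompose (ƛ s ⊕ v)) (dec s v v≢e (decompose s) (decompose v)) refl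

  γ : Carrier → Carrier
  γ t = t ⊕ ƛ e

  -- e ⊖ w = w;  ƛ s ⊖ w = ƛ (s ⊖ w);  (ƛ s ⊕ v) ⊖ w = ƛ s ⊕ (v ⊖ w) for v ≢ e.
  module ⊖-Fold (w : Carrier) = Fold w ƛ (λ s _ v⊖w → ƛ s ⊕ v⊖w)

  infixr 6 _⊖_
  _⊖_ : Carrier → Carrier → Carrier
  t ⊖ w = ⊖-Fold.fold w t

  -- The second argument of Fold is the case v = e of h (ƛ u ⊕ v) = h v ⊖ γ (h u).
  module h-Fold = Fold e (λ hu → e ⊖ γ hu) (λ _ hu hv → hv ⊖ γ hu)

  h : Carrier → Carrier
  h = h-Fold.fold

  -- ⊖ and h satisfy the equations below, which also determine them.

  ⊖-e : ∀ w → e ⊖ w ≡ w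
  ⊖-e w = ⊖-Fold.fold-e w

  ⊖-ƛ : ∀ s w → ƛ s ⊖ w ≡ ƛ (s ⊖ w)
  ⊖-ƛ s w = ⊖-Fold.fold-ƛ w s

  private
    ⊖-ƛ⊕ : ∀ s v w → v ≢ e → (ƛ s ⊕ v) ⊖ w ≡ ƛ s ⊕ (v ⊖ w)
    ⊖-ƛ⊕ s v w v≢e = ⊖-Fold.fold-⊕ w s v v≢e

    ⊕≢e : ∀ v u → u ≢ e → v ⊕ u ≢ e
    ⊕≢e v u u≢e eq = u≢e (size≡0⇒e u (m+n≡0⇒n≡0 (size v)
      (trans (sym (size-⊕ v u)) (trans (cong size eq) size-e))))

    ⊖-⊕-dec : ∀ {t} → Decomposition t → ∀ u w → t ≢ e → u ≢ e →
              (t ⊕ u) ⊖ w ≡ t ⊕ (u ⊖ w)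
    ⊖-⊕-dec empty u w e≢e _ = ⊥-elim (e≢e refl)
    ⊖-⊕-dec (ind s _) u w _ u≢e = ⊖-ƛ⊕ s u w u≢e
    ⊖-⊕-dec (dec s v v≢e _ d) u w _ u≢e =
      trans (cong (_⊖ w) (⊕-assoc (ƛ s) v u))
      (trans (⊖-ƛ⊕ s (v ⊕ u) w (⊕≢e v u u≢e))
      (trans (cong (ƛ s ⊕_) (⊖-⊕-dec d u w v≢e u≢e))
             (sym (⊕-assoc (ƛ s) v (u ⊖ w)))))

  ⊖-⊕ : ∀ t u w → t ≢ e → u ≢ e → (t ⊕ u) ⊖ w ≡ t ⊕ (u ⊖ w)
  ⊖-⊕ t = ⊖-⊕-dec (decompose t)

  h-e : h e ≡ e
  h-e = h-Fold.fold-e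

  private
    h-⊕-dec : ∀ u {v} → Decomposition v → h (ƛ u ⊕ v) ≡ h v ⊖ γ (h u)
    h-⊕-dec u empty =
      trans (cong h (⊕-identityʳ (ƛ u)))
      (trans (h-Fold.fold-ƛ u) (cong (_⊖ γ (h u)) (sym h-e)))
    h-⊕-dec u (ind s _) =
      h-Fold.fold-⊕ u (ƛ s) (λ eq → e-not-indecomposable (s , sym eq))
    h-⊕-dec u (dec s v v≢e _ _) =
      h-Fold.fold-⊕ u (ƛ s ⊕ v)
        (λ eq → e-not-decomposable (ƛ s , v , (s , refl) , v≢e , sym eq))

  h-⊕ : ∀ u v → h (ƛ u ⊕ v) ≡ h v ⊖ γ (h u)
  h-⊕ u v = h-⊕-dec u (decompose v)

  FixedPointOfSize : ℕ → Set ℓ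
  FixedPointOfSize n = ∃ λ t → size t ≡ n × h t ≡ t

catalan : ℕ → ℕ
catalan k = ((2 * k) C k) / suc k

{-# OPTIONS --safe #-}

-- Every nonempty t is also uniquely u ⊕ ƛ v.  Since h turns ⊕ into ⊖
-- (reversing the factors), h (u ⊕ ƛ v) ≡ h v ⊕ ƛ (h u): up to h, the map
-- h just swaps the two components.  Hence h is a size-preserving involution and
-- u ⊕ ƛ v is fixed iff v ≡ h u.
--
-- Replacing the first entry ƛ u ⊕ v of a vector of k + 1 elements by the two
-- entries u, v (and dropping it if it is e) shows that the vectors of length k and
-- total size n are counted by ballot numbers C(2n+k-1, n) - C(2n+k-1, n-1); the
-- Catalan numbers are the case k = 1.
module Submission where

open import Defs
open import Axiom.UniquenessOfIdentityProofs.WithK using (uip)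
open import Data.Empty using (⊥-elim)
open import Data.Fin using (Fin; zero)
open import Data.Fin.Properties using (+↔⊎)
open import Data.Nat using (ℕ; zero; suc; _+_; _*_; _∸_; _/_; _≤_; _<_)
open import Data.Nat.Combinatorics
  using (_C_; nCk≡nC[n∸k]; nCk+nC[k+1]≡[n+1]C[k+1]; nC1≡n; k>n⇒nCk≡0)
open import Data.Nat.Divisibility using (_∣_; ∣m+n∣m⇒∣n; m∣m*n; ∣1⇒≡1)
open import Data.Nat.DivMod using (m*n/n≡m)
open import Data.Nat.Properties
  using (+-assoc; +-comm; +-identityʳ; +-suc; +-cancelʳ-≡; *-cancelˡ-≡; *-comm; *-distribˡ-+;
         *-identityʳ; m≤n+m; m+n≡0⇒m≡0; m+n≡0⇒n≡0; m+n∸n≡m; suc-injective; n<1+n; <-irrefl; ≡-irrelevant)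
open import Data.Nat.Tactic.RingSolver using (solve-∀)
open import Data.Product using (Σ; Σ-syntax; ∃; _×_; _,_; proj₁; proj₂; map₂)
open import Data.Sum using (_⊎_; inj₁; inj₂)
open import Data.Sum.Function.Propositional using (_⊎-↔_)
open import Data.Vec using (Vec; []; _∷_; map; replicate; sum)
open import Data.Vec.Properties using (∷-injective)
open import Function.Base using (case_of_)
open import Function.Bundles using (_⇔_; _↔_; mk⇔; mk⤖; mk↔ₛ′)
open import Function.Consequences.Propositional using (strictlySurjective⇒surjective)
open import Function.Definitions using (Injective; StrictlySurjective)
open import Function.Properties.Bijection using (⤖⇒↔)
open import Function.Properties.Inverse using (↔-sym; ↔-trans)
open import Level using (Level)
open import Relation.Binary.PropositionalEquality
  using (_≡_; _≢_; refl; sym; trans; cong; cong₂; subst; module ≡-Reasoning)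
open import Relation.Nullary using (¬_; Irrelevant; contradiction)

open ≡-Reasoning

-- Bijections and equality in subset types.

bijective⇒↔ : ∀ {a b} {A : Set a} {B : Set b} {f : A → B} →
              Injective _≡_ _≡_ f → StrictlySurjective _≡_ f → A ↔ B
bijective⇒↔ inj surj = ⤖⇒↔ (mk⤖ (inj , strictlySurjective⇒surjective surj))

-- Lets elements of `Sized`, `Forest` and `FixedPointOfSize` be compared by their underlying data
-- alone.
Σ-≡ : ∀ {a p} {A : Set a} {P : A → Set p} → (∀ {x} → Irrelevant (P x)) →
      {s t : Σ A P} → proj₁ s ≡ proj₁ t → s ≡ t
Σ-≡ irr {x , p} {_ , q} refl = cong (x ,_) (irr p q)

×-irrelevant : ∀ {a b} {A : Set a} {B : Set b} →
               Irrelevant A → Irrelevant B → Irrelevant (A × B)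
×-irrelevant irrᴬ irrᴮ (a , b) (a′ , b′) = cong₂ _,_ (irrᴬ a a′) (irrᴮ b b′)

-- Ballot numbers, binomial coefficients and Catalan numbers.

ballot : ℕ → ℕ → ℕ
ballot k       zero    = 1
ballot zero    (suc n) = 0
ballot (suc k) (suc n) = ballot k (suc n) + ballot (suc (suc k)) n

-- The closed form at n + 1, moved so that no subtraction occurs.
ballot-closed : ∀ k n →
  ballot k (suc n) + (n + suc (n + k)) C n ≡ (n + suc (n + k)) C suc n
-- The ballot number is 0 here, and the two binomials agree by symmetry, since `n` and `suc n` add
-- up to the upper index.
ballot-closed zero n rewrite +-identityʳ n =
  trans (nCk≡nC[n∸k] {n} (subst (n ≤_) (+-comm (suc n) n) (m≤n+m n (suc n))))
        (cong ((n + suc n) C_) (trans (cong (_∸ n) (+-comm n (suc n))) (m+n∸n≡m (suc n) n)))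
ballot-closed (suc k) zero = begin
  ballot k 1 + 1 + 1               ≡⟨ cong (_+ 1) (ballot-closed k 0) ⟩
  suc k C 1 + 1                    ≡⟨ +-comm (suc k C 1) 1 ⟩
  1 + suc k C 1                    ≡⟨ nCk+nC[k+1]≡[n+1]C[k+1] (suc k) 0 ⟩
  suc (suc k) C 1                  ∎
ballot-closed (suc k) (suc n) = begin
  ballot k (suc (suc n)) + ballot (suc (suc k)) (suc n) + (suc n + suc (suc n + suc k)) C suc n
    ≡⟨ cong (λ z → ballot k (suc (suc n)) + ballot (suc (suc k)) (suc n) + z C suc n) N′≡1+N ⟩
  a + b + suc N C suc n            ≡⟨ cong (a + b +_) (nCk+nC[k+1]≡[n+1]C[k+1] N n) ⟨
  -- Both smaller instances have the same upper index `N`. Pairing `b` with `N C n` and `a` with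
  -- `N C suc n` fits them to the two induction hypotheses.
  a + b + (N C n + N C suc n)      ≡⟨ regroup a b (N C n) (N C suc n) ⟩
  (b + N C n) + (a + N C suc n)    ≡⟨ cong₂ _+_
         (subst (λ z → b + z C n ≡ z C suc n) (shift′ n k) (ballot-closed (suc (suc k)) n))
         (ballot-closed k (suc n)) ⟩
  N C suc n + N C suc (suc n)      ≡⟨ nCk+nC[k+1]≡[n+1]C[k+1] N (suc n) ⟩
  suc N C suc (suc n)              ≡⟨ cong (_C suc (suc n)) N′≡1+N ⟨
  (suc n + suc (suc n + suc k)) C suc (suc n) ∎
  where
  N = suc n + suc (suc n + k)
  a = ballot k (suc (suc n))
  b = ballot (suc (suc k)) (suc n)

  shift : ∀ n k → suc n + suc (suc n + suc k) ≡ suc (suc n + suc (suc n + k))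
  shift = solve-∀

  shift′ : ∀ n k → n + suc (n + suc (suc k)) ≡ suc n + suc (suc n + k)
  shift′ = solve-∀

  N′≡1+N : suc n + suc (suc n + suc k) ≡ suc N
  N′≡1+N = shift n k

  regroup : ∀ a b c d → a + b + (c + d) ≡ (b + c) + (a + d)
  regroup = solve-∀

-- For positive `j` both sides are `(j + k)! / ((j - 1)! k!)`. Induction through Pascal's rule
-- avoids dividing factorials. It serves to turn the ballot difference into the Catalan quotient.
C-absorption : ∀ j k → j * ((j + k) C k) ≡ suc k * ((j + k) C suc k)
C-absorption zero    k       = sym (trans (cong (suc k *_) (k>n⇒nCk≡0 (n<1+n k))) (*-comm (suc k) 0))
C-absorption (suc j) zero    = begin
  suc j * 1                ≡⟨ *-identityʳ (suc j) ⟩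
  suc j                    ≡⟨ +-identityʳ (suc j) ⟨
  suc j + 0                ≡⟨ nC1≡n (suc j + 0) ⟨
  (suc j + 0) C 1          ≡⟨ +-identityʳ _ ⟨
  1 * ((suc j + 0) C 1)    ∎
C-absorption (suc j) (suc k) = begin
  suc j * (suc N C suc k)                    ≡⟨ cong (suc j *_) (nCk+nC[k+1]≡[n+1]C[k+1] N k) ⟨
  suc j * (N C k + N C suc k)                ≡⟨ expand j (N C k) (N C suc k) ⟩
  suc j * (N C k) + N C suc k + j * (N C suc k)
    ≡⟨ cong₂ (λ x y → x + N C suc k + y) ih (C-absorption j (suc k)) ⟩
  suc k * (N C suc k) + N C suc k + suc (suc k) * (N C suc (suc k))
    ≡⟨ collect k (N C suc k) (N C suc (suc k)) ⟩
  suc (suc k) * (N C suc k + N C suc (suc k))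
    ≡⟨ cong (suc (suc k) *_) (nCk+nC[k+1]≡[n+1]C[k+1] N (suc k)) ⟩
  suc (suc k) * (suc N C suc (suc k))        ∎
  where
  N = j + suc k

  expand : ∀ j x y → suc j * (x + y) ≡ suc j * x + y + j * y
  expand = solve-∀

  collect : ∀ k x y → suc k * x + x + suc (suc k) * y ≡ suc (suc k) * (x + y)
  collect = solve-∀

  ih : suc j * (N C k) ≡ suc k * (N C suc k)
  ih = subst (λ z → suc j * (z C k) ≡ suc k * (z C suc k)) (sym (+-suc j k)) (C-absorption (suc j) k)

ballot≡catalan : ∀ n → ballot 1 n ≡ catalan n
ballot≡catalan zero    = refl
ballot≡catalan (suc n) = begin
  B                                    ≡⟨ m*n/n≡m B (suc (suc n)) ⟨
  B * suc (suc n) / suc (suc n)        ≡⟨ cong (_/ suc (suc n)) B*[n+2]≡NC[n+1] ⟩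
  (N C suc n) / suc (suc n)            ≡⟨ cong (λ z → (z C suc n) / suc (suc n)) (N≡2[n+1] n) ⟩
  catalan (suc n)                      ∎
  where
  B = ballot 1 (suc n)
  N = suc (suc n) + n

  N≡2[n+1] : ∀ n → suc (suc n) + n ≡ 2 * suc n
  N≡2[n+1] = solve-∀

  shift : ∀ n → n + suc (n + 1) ≡ suc (suc n) + n
  shift = solve-∀

  split : ∀ n x → suc (suc n) * x ≡ x + suc n * x
  split = solve-∀

  closed : B + N C n ≡ N C suc n
  closed = subst (λ z → B + z C n ≡ z C suc n) (shift n) (ballot-closed 1 n)

  B*[n+2]≡NC[n+1] : B * suc (suc n) ≡ N C suc n
  -- Adding `suc n * (N C suc n)`, which absorption identifies with `suc (suc n) * (N C n)`, makes
  -- `closed` applicable as a multiple of `suc (suc n)`.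
  B*[n+2]≡NC[n+1] = +-cancelʳ-≡ (suc n * (N C suc n)) _ _ (begin
    B * suc (suc n) + suc n * (N C suc n)             ≡⟨ cong₂ _+_ (*-comm B (suc (suc n))) (sym (C-absorption (suc (suc n)) n)) ⟩
    suc (suc n) * B + suc (suc n) * (N C n)           ≡⟨ *-distribˡ-+ (suc (suc n)) B (N C n) ⟨
    suc (suc n) * (B + N C n)                         ≡⟨ cong (suc (suc n) *_) closed ⟩
    suc (suc n) * (N C suc n)                         ≡⟨ split n (N C suc n) ⟩
    N C suc n + suc n * (N C suc n)                   ∎)

module CatalanProperties {ℓ : Level} (S : CatalanStructure ℓ) where
  open CatalanStructure S
  open Operations S

  -- Splitting off the first or the last factor.

  e≢ƛ⊕ : ∀ u v → e ≢ ƛ u ⊕ v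
  e≢ƛ⊕ u v eq with () ← trans (sym size-e)
    (trans (cong size eq) (trans (size-⊕ (ƛ u) v) (cong (_+ size v) (size-ƛ u))))

  e≢⊕ƛ : ∀ u v → e ≢ u ⊕ ƛ v
  e≢⊕ƛ u v eq with () ← trans (sym (size-ƛ v))
    (m+n≡0⇒n≡0 (size u) (trans (sym (size-⊕ u (ƛ v))) (trans (cong size (sym eq)) size-e)))

  size-ƛ⊕ : ∀ u v → size (ƛ u ⊕ v) ≡ suc (size u + size v)
  size-ƛ⊕ u v = trans (size-⊕ (ƛ u) v) (cong (_+ size v) (size-ƛ u))

  size-⊕ƛ : ∀ u v → size (u ⊕ ƛ v) ≡ suc (size u + size v)
  size-⊕ƛ u v = trans (size-⊕ u (ƛ v)) (trans (cong (size u +_) (size-ƛ v)) (+-suc (size u) (size v)))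

  -- The indecomposable and decomposable forms merge into one case, because `ƛ s` is `ƛ s ⊕ e`.
  inductionˡ : ∀ {p} (P : Carrier → Set p) → P e →
               (∀ u v → P u → P v → P (ƛ u ⊕ v)) → ∀ t → P t
  inductionˡ P P-e P-ƛ⊕ t = go (decompose t)
    where
    go : ∀ {t} → Decomposition t → P t
    go empty             = P-e
    go (ind s d)         = subst P (⊕-identityʳ (ƛ s)) (P-ƛ⊕ s e (go d) P-e)
    go (dec s v _ d₁ d₂) = P-ƛ⊕ s v (go d₁) (go d₂)

  -- The left induction has to be run on all left translates of P, because
  -- x ⊕ (ƛ u ⊕ v) is reached by attaching ƛ u to x on the right first.
  inductionʳ : ∀ {p} (P : Carrier → Set p) → P e →
               (∀ u v → P u → P v → P (u ⊕ ƛ v)) → ∀ t → P t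
  inductionʳ P P-e P-⊕ƛ t = subst P (⊕-identityˡ t) (go t e P-e)
    where
    go : ∀ t x → P x → P (x ⊕ t)
    go = inductionˡ (λ t → ∀ x → P x → P (x ⊕ t))
      (λ x Px → subst P (sym (⊕-identityʳ x)) Px)
      (λ u v Pu Pv x Px → subst P (⊕-assoc x (ƛ u) v)
        (Pv (x ⊕ ƛ u) (P-⊕ƛ x u Px (subst P (⊕-identityˡ u) (Pu e P-e)))))

  data Viewˡ : Carrier → Set ℓ where
    emptyˡ : Viewˡ e
    nodeˡ  : ∀ u v → Viewˡ (ƛ u ⊕ v)

  viewˡ : ∀ t → Viewˡ t
  viewˡ = inductionˡ Viewˡ emptyˡ (λ u v _ _ → nodeˡ u v)

  data Viewʳ : Carrier → Set ℓ where
    emptyʳ : Viewʳ e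
    nodeʳ  : ∀ u v → Viewʳ (u ⊕ ƛ v)

  viewʳ : ∀ t → Viewʳ t
  viewʳ = inductionʳ Viewʳ emptyʳ (λ u v _ _ → nodeʳ u v)

  -- The structure gives uniqueness separately for indecomposables and for `v ≢ e`. If exactly one
  -- of `v`, `v′` is `e`, a single element would be both indecomposable and decomposable.
  ƛ⊕-injective : ∀ {u v u′ v′} → ƛ u ⊕ v ≡ ƛ u′ ⊕ v′ → u ≡ u′ × v ≡ v′
  ƛ⊕-injective {u} {v} {u′} {v′} eq with viewˡ v | viewˡ v′
  ... | emptyˡ | emptyˡ =
    ƛ-injective (trans (sym (⊕-identityʳ (ƛ u))) (trans eq (⊕-identityʳ (ƛ u′)))) , refl
  ... | emptyˡ | nodeˡ a b =
    ⊥-elim (indecomposable-not-decomposable (u , refl)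
      (ƛ u′ , ƛ a ⊕ b , (u′ , refl) , (λ v′≡e → e≢ƛ⊕ a b (sym v′≡e)) ,
       trans (sym (⊕-identityʳ (ƛ u))) eq))
  ... | nodeˡ a b | emptyˡ =
    ⊥-elim (indecomposable-not-decomposable (u′ , refl)
      (ƛ u , ƛ a ⊕ b , (u , refl) , (λ v≡e → e≢ƛ⊕ a b (sym v≡e)) ,
       trans (sym (⊕-identityʳ (ƛ u′))) (sym eq)))
  ... | nodeˡ a b | nodeˡ a′ b′
    with ⊕-unique (u , refl) (λ v≡e → e≢ƛ⊕ a b (sym v≡e))
                  (u′ , refl) (λ v′≡e → e≢ƛ⊕ a′ b′ (sym v′≡e)) eq
  ... | ƛu≡ƛu′ , v≡v′ = ƛ-injective ƛu≡ƛu′ , v≡v′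

  -- Uniqueness is only given for the first factor, so first factors are peeled off `u` and `u′` in
  -- parallel. If one runs out before the other, some `b ⊕ ƛ _` would have to equal `e`.
  ⊕ƛ-injective : ∀ {u v u′ v′} → u ⊕ ƛ v ≡ u′ ⊕ ƛ v′ → u ≡ u′ × v ≡ v′
  ⊕ƛ-injective {u} {v} {u′} {v′} = go u u′
    where
    ƛ⊕e : ∀ v → e ⊕ ƛ v ≡ ƛ v ⊕ e
    ƛ⊕e v = trans (⊕-identityˡ (ƛ v)) (sym (⊕-identityʳ (ƛ v)))

    go : ∀ u u′ → u ⊕ ƛ v ≡ u′ ⊕ ƛ v′ → u ≡ u′ × v ≡ v′
    go = inductionˡ (λ u → ∀ u′ → u ⊕ ƛ v ≡ u′ ⊕ ƛ v′ → u ≡ u′ × v ≡ v′) base step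
      where
      base : ∀ u′ → e ⊕ ƛ v ≡ u′ ⊕ ƛ v′ → e ≡ u′ × v ≡ v′
      base u′ eq with viewˡ u′
      ... | emptyˡ = refl , proj₁ (ƛ⊕-injective (trans (sym (ƛ⊕e v)) (trans eq (ƛ⊕e v′))))
      ... | nodeˡ a b with ƛ⊕-injective (trans (sym (ƛ⊕e v)) (trans eq (⊕-assoc (ƛ a) b (ƛ v′))))
      ...   | _ , e≡b⊕ƛv′ = ⊥-elim (e≢⊕ƛ b v′ e≡b⊕ƛv′)

      step : ∀ a b → _ → (∀ u′ → b ⊕ ƛ v ≡ u′ ⊕ ƛ v′ → b ≡ u′ × v ≡ v′) →
             ∀ u′ → (ƛ a ⊕ b) ⊕ ƛ v ≡ u′ ⊕ ƛ v′ → ƛ a ⊕ b ≡ u′ × v ≡ v′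
      step a b _ ih u′ eq with viewˡ u′
      ... | emptyˡ with ƛ⊕-injective (trans (sym (⊕-assoc (ƛ a) b (ƛ v))) (trans eq (ƛ⊕e v′)))
      ...   | _ , b⊕ƛv≡e = ⊥-elim (e≢⊕ƛ b v (sym b⊕ƛv≡e))
      step a b _ ih u′ eq | nodeˡ a′ b′
        with ƛ⊕-injective (trans (sym (⊕-assoc (ƛ a) b (ƛ v))) (trans eq (⊕-assoc (ƛ a′) b′ (ƛ v′))))
      ...   | refl , eq′ with ih b′ eq′
      ...     | refl , v≡v′ = refl , v≡v′

  -- The operation `⊖` and the involution `h`.

  -- Extends `⊖-⊕` to `u` equal to `e`, so that `⊖` becomes a recursion on right nodes that only
  -- descends into the last component.
  ⊕ƛ-⊖ : ∀ u v w → (u ⊕ ƛ v) ⊖ w ≡ u ⊕ ƛ (v ⊖ w)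
  ⊕ƛ-⊖ u v w with viewˡ u
  ... | emptyˡ = begin
    (e ⊕ ƛ v) ⊖ w      ≡⟨ cong (_⊖ w) (⊕-identityˡ (ƛ v)) ⟩
    ƛ v ⊖ w            ≡⟨ ⊖-ƛ v w ⟩
    ƛ (v ⊖ w)          ≡⟨ ⊕-identityˡ _ ⟨
    e ⊕ ƛ (v ⊖ w)      ∎
  ... | nodeˡ a b =
    trans (⊖-⊕ (ƛ a ⊕ b) (ƛ v) w (λ eq → e≢ƛ⊕ a b (sym eq))
                (λ eq → e-not-indecomposable (v , sym eq)))
          (cong ((ƛ a ⊕ b) ⊕_) (⊖-ƛ v w))

  -- By `⊕ƛ-⊖`, `⊖` treats right nodes as list append treats cons cells, with `e` as the empty list;
  -- the proof is that of associativity of append.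
  ⊖-assoc : ∀ t v w → (t ⊖ v) ⊖ w ≡ t ⊖ (v ⊖ w)
  ⊖-assoc t v w = inductionʳ (λ t → (t ⊖ v) ⊖ w ≡ t ⊖ (v ⊖ w))
    (trans (cong (_⊖ w) (⊖-e v)) (sym (⊖-e (v ⊖ w))))
    (λ a b _ ih → begin
      ((a ⊕ ƛ b) ⊖ v) ⊖ w      ≡⟨ cong (_⊖ w) (⊕ƛ-⊖ a b v) ⟩
      (a ⊕ ƛ (b ⊖ v)) ⊖ w      ≡⟨ ⊕ƛ-⊖ a (b ⊖ v) w ⟩
      a ⊕ ƛ ((b ⊖ v) ⊖ w)      ≡⟨ cong (λ z → a ⊕ ƛ z) ih ⟩
      a ⊕ ƛ (b ⊖ (v ⊖ w))      ≡⟨ ⊕ƛ-⊖ a b (v ⊖ w) ⟨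
      (a ⊕ ƛ b) ⊖ (v ⊖ w)      ∎) t

  ⊖-identityʳ : ∀ t → t ⊖ e ≡ t
  ⊖-identityʳ = inductionʳ (λ t → t ⊖ e ≡ t) (⊖-e e)
    (λ a b _ ih → trans (⊕ƛ-⊖ a b e) (cong (λ z → a ⊕ ƛ z) ih))

  -- Each factor `ƛ a` peeled from the left of `u` contributes `γ (h a)` at the right end of the
  -- result; `⊖-assoc` collects these contributions into `h u`.
  h-antihomo : ∀ u w → h (u ⊕ w) ≡ h w ⊖ h u
  h-antihomo u w = inductionˡ (λ u → h (u ⊕ w) ≡ h w ⊖ h u)
    (begin
      h (e ⊕ w)     ≡⟨ cong h (⊕-identityˡ w) ⟩
      h w           ≡⟨ ⊖-identityʳ (h w) ⟨
      h w ⊖ e       ≡⟨ cong (h w ⊖_) h-e ⟨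
      h w ⊖ h e     ∎)
    (λ a b _ ih → begin
      h ((ƛ a ⊕ b) ⊕ w)          ≡⟨ cong h (⊕-assoc (ƛ a) b w) ⟩
      h (ƛ a ⊕ (b ⊕ w))          ≡⟨ h-⊕ a (b ⊕ w) ⟩
      h (b ⊕ w) ⊖ γ (h a)        ≡⟨ cong (_⊖ γ (h a)) ih ⟩
      (h w ⊖ h b) ⊖ γ (h a)      ≡⟨ ⊖-assoc (h w) (h b) (γ (h a)) ⟩
      h w ⊖ (h b ⊖ γ (h a))      ≡⟨ cong (h w ⊖_) (h-⊕ a b) ⟨
      h w ⊖ h (ƛ a ⊕ b)          ∎) u

  h-ƛ : ∀ v → h (ƛ v) ≡ γ (h v)
  h-ƛ v = begin
    h (ƛ v)            ≡⟨ cong h (⊕-identityʳ (ƛ v)) ⟨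
    h (ƛ v ⊕ e)        ≡⟨ h-⊕ v e ⟩
    h e ⊖ γ (h v)      ≡⟨ cong (_⊖ γ (h v)) h-e ⟩
    e ⊖ γ (h v)        ≡⟨ ⊖-e (γ (h v)) ⟩
    γ (h v)            ∎

  h-⊕ƛ : ∀ u v → h (u ⊕ ƛ v) ≡ h v ⊕ ƛ (h u)
  h-⊕ƛ u v = begin
    h (u ⊕ ƛ v)            ≡⟨ h-antihomo u (ƛ v) ⟩
    h (ƛ v) ⊖ h u          ≡⟨ cong (_⊖ h u) (h-ƛ v) ⟩
    -- The `ƛ e` that `γ` appends is an empty last component, and `⊖ h u` fills it.
    (h v ⊕ ƛ e) ⊖ h u      ≡⟨ ⊕ƛ-⊖ (h v) e (h u) ⟩
    h v ⊕ ƛ (e ⊖ h u)      ≡⟨ cong (λ z → h v ⊕ ƛ z) (⊖-e (h u)) ⟩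
    h v ⊕ ƛ (h u)          ∎

  h-involutive : ∀ t → h (h t) ≡ t
  h-involutive = inductionʳ (λ t → h (h t) ≡ t) (trans (cong h h-e) h-e)
    (λ u v ihᵘ ihᵛ → begin
      h (h (u ⊕ ƛ v))          ≡⟨ cong h (h-⊕ƛ u v) ⟩
      h (h v ⊕ ƛ (h u))        ≡⟨ h-⊕ƛ (h v) (h u) ⟩
      h (h u) ⊕ ƛ (h (h v))    ≡⟨ cong₂ (λ x y → x ⊕ ƛ y) ihᵘ ihᵛ ⟩
      u ⊕ ƛ v                  ∎)

  size-h : ∀ t → size (h t) ≡ size t
  size-h = inductionʳ (λ t → size (h t) ≡ size t) (cong size h-e)
    (λ u v ihᵘ ihᵛ → begin
      size (h (u ⊕ ƛ v))               ≡⟨ cong size (h-⊕ƛ u v) ⟩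
      size (h v ⊕ ƛ (h u))             ≡⟨ size-⊕ƛ (h v) (h u) ⟩
      suc (size (h v) + size (h u))    ≡⟨ cong₂ (λ x y → suc (x + y)) ihᵛ ihᵘ ⟩
      suc (size v + size u)            ≡⟨ cong suc (+-comm (size v) (size u)) ⟩
      suc (size u + size v)            ≡⟨ size-⊕ƛ u v ⟨
      size (u ⊕ ƛ v)                   ∎)

  -- Fixed points of `h` and their sizes.

  h-fixed : ∀ u → h (u ⊕ ƛ (h u)) ≡ u ⊕ ƛ (h u)
  h-fixed u = trans (h-⊕ƛ u (h u)) (cong (_⊕ ƛ (h u)) (h-involutive u))

  h-fixed⁻¹ : ∀ t → h t ≡ t → t ≡ e ⊎ (∃ λ u → t ≡ u ⊕ ƛ (h u))
  h-fixed⁻¹ t = go (viewʳ t)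
    where
    go : ∀ {t} → Viewʳ t → h t ≡ t → t ≡ e ⊎ (∃ λ u → t ≡ u ⊕ ƛ (h u))
    go emptyʳ      _  = inj₁ refl
    go (nodeʳ u v) eq =
      -- Comparing the last components of `h v ⊕ ƛ (h u)` and `u ⊕ ƛ v` gives `h u ≡ v`.
      inj₂ (u , cong (λ z → u ⊕ ƛ z) (sym (proj₂ (⊕ƛ-injective (trans (sym (h-⊕ƛ u v)) eq)))))

  h-fixed⇔ : ∀ t → (h t ≡ t) ⇔ (t ≡ e ⊎ (∃ λ u → t ≡ u ⊕ ƛ (h u)))
  h-fixed⇔ t = mk⇔ (h-fixed⁻¹ t) λ where
    (inj₁ refl)       → h-e
    (inj₂ (u , refl)) → h-fixed u

  size-fixed : ∀ u → size (u ⊕ ƛ (h u)) ≡ 2 * size u + 1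
  size-fixed u = begin
    size (u ⊕ ƛ (h u))           ≡⟨ size-⊕ƛ u (h u) ⟩
    suc (size u + size (h u))    ≡⟨ cong (λ z → suc (size u + z)) (size-h u) ⟩
    suc (size u + size u)        ≡⟨ double (size u) ⟩
    2 * size u + 1               ∎
    where
    double : ∀ n → suc (n + n) ≡ 2 * n + 1
    double = solve-∀

  fixed↔sized : ∀ k → FixedPointOfSize (2 * k + 1) ↔ Sized k
  fixed↔sized k = ↔-sym (bijective⇒↔ {f = toFixed} injective surjective)
    where
    toFixed : Sized k → FixedPointOfSize (2 * k + 1)
    toFixed (u , p) =
      u ⊕ ƛ (h u) , trans (size-fixed u) (cong (λ n → 2 * n + 1) p) , h-fixed u

    injective : Injective _≡_ _≡_ toFixed
    injective eq = Σ-≡ ≡-irrelevant (proj₁ (⊕ƛ-injective (cong proj₁ eq)))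

    preimage : ∀ t → size t ≡ 2 * k + 1 → t ≡ e ⊎ (∃ λ u → t ≡ u ⊕ ƛ (h u)) →
               Σ[ x ∈ Sized k ] proj₁ (toFixed x) ≡ t
    preimage t p (inj₁ t≡e)
      -- The size of `e` is 0; commuting the sum exposes `2 * k + 1` as a successor.
      with () ← trans (sym size-e) (trans (cong size (sym t≡e)) (trans p (+-comm (2 * k) 1)))
    preimage t p (inj₂ (u , t≡)) =
      (u , *-cancelˡ-≡ (size u) k 2 (+-cancelʳ-≡ 1 (2 * size u) (2 * k)
             (trans (sym (size-fixed u)) (trans (cong size (sym t≡)) p)))) ,
      sym t≡

    surjective : StrictlySurjective _≡_ toFixed
    surjective (t , p , ht≡t) =
      -- The equation `h t ≡ t` lives in the arbitrary type `Carrier`, so its irrelevance is taken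
      -- from `uip`, unlike that of the size equation in `ℕ`.
      map₂ (Σ-≡ (×-irrelevant ≡-irrelevant uip)) (preimage t p (h-fixed⁻¹ t ht≡t))

  fixed-size-odd : ∀ t → h t ≡ t → 0 < size t → ¬ (2 ∣ size t)
  fixed-size-odd t ht≡t 0<t 2∣t = case h-fixed⁻¹ t ht≡t of λ where
    (inj₁ t≡e)      → <-irrefl (sym (trans (cong size t≡e) size-e)) 0<t
    -- If 2 divided `2 * size u + 1`, it would divide 1.
    (inj₂ (u , t≡)) → contradiction
      (∣1⇒≡1 (∣m+n∣m⇒∣n (subst (2 ∣_) (trans (cong size t≡) (size-fixed u)) 2∣t) (m∣m*n (size u))))
      λ ()

  -- Counting elements by size.

  Forest : ℕ → ℕ → Set ℓ
  Forest k n = Σ[ ts ∈ Vec Carrier k ] sum (map size ts) ≡ n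

  Forest-0 : ∀ k → Fin 1 ↔ Forest k 0
  Forest-0 k = bijective⇒↔ {f = λ _ → replicate k e , sum-e k}
    (λ { {zero} {zero} _ → refl })
    (λ (ts , p) → zero , Σ-≡ ≡-irrelevant (sym (all-e ts p)))
    where
    sum-e : ∀ k → sum (map size (replicate k e)) ≡ 0
    sum-e zero    = refl
    sum-e (suc k) = cong₂ _+_ size-e (sum-e k)

    all-e : ∀ {k} (ts : Vec Carrier k) → sum (map size ts) ≡ 0 → ts ≡ replicate k e
    all-e []       _ = refl
    all-e (t ∷ ts) p = cong₂ _∷_ (size≡0⇒e t (m+n≡0⇒m≡0 (size t) p))
                                 (all-e ts (m+n≡0⇒n≡0 (size t) p))

  -- The bijective form of the recursion for `ballot`: a first entry `e` accounts for the left
  -- summand, a first entry `ƛ u ⊕ v` for the right one, where the lost `ƛ` lowers the size by one.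
  -- `viewˡ` shows that these cases are exhaustive, `e≢ƛ⊕` that they are disjoint.
  Forest-suc : ∀ k n → (Forest k (suc n) ⊎ Forest (suc (suc k)) n) ↔ Forest (suc k) (suc n)
  Forest-suc k n = bijective⇒↔ {f = cons} injective surjective
    where
    sum-e∷ : ∀ (ts : Vec Carrier k) → sum (map size (e ∷ ts)) ≡ sum (map size ts)
    sum-e∷ ts = cong (_+ sum (map size ts)) size-e

    sum-ƛ⊕∷ : ∀ u v (ts : Vec Carrier k) →
              sum (map size ((ƛ u ⊕ v) ∷ ts)) ≡ suc (sum (map size (u ∷ v ∷ ts)))
    sum-ƛ⊕∷ u v ts = trans (cong (_+ sum (map size ts)) (size-ƛ⊕ u v))
                           (cong suc (+-assoc (size u) (size v) (sum (map size ts))))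

    cons : Forest k (suc n) ⊎ Forest (suc (suc k)) n → Forest (suc k) (suc n)
    cons (inj₁ (ts , p))         = e ∷ ts , trans (sum-e∷ ts) p
    cons (inj₂ (u ∷ v ∷ ts , p)) = (ƛ u ⊕ v) ∷ ts , trans (sum-ƛ⊕∷ u v ts) (cong suc p)

    injective : Injective _≡_ _≡_ cons
    injective {inj₁ _} {inj₁ _} eq with ∷-injective (cong proj₁ eq)
    ... | _ , ts≡ts′ = cong inj₁ (Σ-≡ ≡-irrelevant ts≡ts′)
    injective {inj₁ _} {inj₂ (u ∷ v ∷ _ , _)} eq with ∷-injective (cong proj₁ eq)
    ... | e≡ƛu⊕v , _ = ⊥-elim (e≢ƛ⊕ u v e≡ƛu⊕v)
    injective {inj₂ (u ∷ v ∷ _ , _)} {inj₁ _} eq with ∷-injective (cong proj₁ eq)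
    ... | ƛu⊕v≡e , _ = ⊥-elim (e≢ƛ⊕ u v (sym ƛu⊕v≡e))
    injective {inj₂ (u ∷ v ∷ _ , _)} {inj₂ (u′ ∷ v′ ∷ _ , _)} eq with ∷-injective (cong proj₁ eq)
    ... | node≡node′ , ts≡ts′ with ƛ⊕-injective node≡node′
    ...   | u≡u′ , v≡v′ =
      cong inj₂ (Σ-≡ ≡-irrelevant (cong₂ _∷_ u≡u′ (cong₂ _∷_ v≡v′ ts≡ts′)))

    surjective : StrictlySurjective _≡_ cons
    surjective (t ∷ ts , p) with viewˡ t
    ... | emptyˡ    = inj₁ (ts , trans (sym (sum-e∷ ts)) p) , Σ-≡ ≡-irrelevant refl
    ... | nodeˡ u v =
      inj₂ (u ∷ v ∷ ts , suc-injective (trans (sym (sum-ƛ⊕∷ u v ts)) p)) , Σ-≡ ≡-irrelevant refl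

  Fin-ballot↔Forest : ∀ k n → Fin (ballot k n) ↔ Forest k n
  Fin-ballot↔Forest k       zero    = Forest-0 k
  -- Both sides are empty, as the empty vector has total size 0.
  Fin-ballot↔Forest zero    (suc n) = mk↔ₛ′ (λ ()) (λ { ([] , ()) }) (λ { ([] , ()) }) (λ ())
  Fin-ballot↔Forest (suc k) (suc n) =
    ↔-trans +↔⊎ (↔-trans (Fin-ballot↔Forest k (suc n) ⊎-↔ Fin-ballot↔Forest (suc (suc k)) n)
                         (Forest-suc k n))

  Sized↔Forest-1 : ∀ n → Sized n ↔ Forest 1 n
  Sized↔Forest-1 n = mk↔ₛ′
    (λ (t , p) → t ∷ [] , trans (+-identityʳ (size t)) p)
    (λ { (t ∷ [] , p) → t , trans (sym (+-identityʳ (size t))) p })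
    (λ { (t ∷ [] , _) → Σ-≡ ≡-irrelevant refl })
    (λ _ → Σ-≡ ≡-irrelevant refl)

  sized↔Fin-catalan : ∀ n → Sized n ↔ Fin (catalan n)
  sized↔Fin-catalan n = subst (λ c → Sized n ↔ Fin c) (ballot≡catalan n)
    (↔-trans (Sized↔Forest-1 n) (↔-sym (Fin-ballot↔Forest 1 n)))

proposition2p11 : ∀ {ℓ : Level} (S : CatalanStructure ℓ) →
  let open CatalanStructure S
      open Operations S
  in (∀ t → (h t ≡ t) ⇔ (t ≡ e ⊎ (∃ λ u → t ≡ u ⊕ ƛ (h u))))
     × (∀ k → (FixedPointOfSize (2 * k + 1) ↔ Sized k) × (Sized k ↔ Fin (catalan k)))
     × (∀ t → h t ≡ t → 0 < size t → ¬ (2 ∣ size t))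
proposition2p11 S =
  h-fixed⇔ , (λ k → fixed↔sized k , sized↔Fin-catalan k) , fixed-size-odd
  where open CatalanProperties S
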